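{- Let $\kappa\leq\lambda$ be infinite cardinals with $\kappa$ regular, and assume $\lambda^{<\kappa}>\lambda$. Then there is a continuous weak $\lambda^+$-measure space $({}^{\kappa}\lambda,\mathfrak{M},\mu)$ on ${}^{\kappa}\lambda$ (with $\mu$ taking values in some positively totally ordered monoid $\mathbb{S}$ with an infinitary sum $\mathsf{Sum}$).
   Context: **Topology.** ${}^{\kappa}\lambda$ is the set of sequences of elements of $\lambda$ of length $\kappa$, with the bounded topology, generated by the cones $\mathbf{N}_s=\{x\in{}^{\kappa}\lambda\mid s\subseteq x\}$ for $s\in{}^{<\kappa}\lambda=\bigcup_{\alpha<\kappa}{}^{\alpha}\lambda$. **Monoids and sums.** A positively totally ordered monoid is $\mathbb{S}=(S,0,+,\leq)$ where $+$ is associative (not necessarily commutative) with neutral element $0$, $\leq$ is a total order, $a\leq b$ and $c\leq d$ imply $a+c\leq b+d$, $0$ is the minimum of $\leq$, and $S\neq\{0\}$. ${}^{<\mathrm{On}}\mathbb{S}$ is the class of all sequences of elements of $S$ of ordinal length; $\mathrm{lh}(s)$ is the length of $s$. An infinitary sum on $\mathbb{S}$ is a partial function $\mathsf{Sum}:{}^{<\mathrm{On}}\mathbb{S}\to\mathbb{S}$ such that: (S1) $\mathsf{Sum}(\emptyset)=0$ and $\mathsf{Sum}(s)=s_0+\dots+s_n$ for every non-empty finite $s=(s_i)_{i\leq n}\in\mathrm{dom}(\mathsf{Sum})$; (S2) (continuity) for all $s\in\mathrm{dom}(\mathsf{Sum})$ of limit length, if $s\restriction\alpha\in\mathrm{dom}(\mathsf{Sum})$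 for cofinally many $\alpha<\mathrm{lh}(s)$, then $\mathsf{Sum}(s)=\sup\{\mathsf{Sum}(s\restriction\alpha)\mid\alpha<\mathrm{lh}(s),\ s\restriction\alpha\in\mathrm{dom}(\mathsf{Sum})\}$. **Measures.** A weakly $\lambda^+$-measurable space is a pair $(X,\mathfrak{M})$ where $X$ is a topological space and $\mathfrak{M}$ is a family of subsets of $X$ closed under unions of size $\leq\lambda$ and containing all open subsets of $X$. A $\lambda^+$-measure on it (with values in $(\mathbb{S},\mathsf{Sum})$) is a partial function $\mu:\mathscr{P}(X)\to\mathbb{S}$ with $\mathfrak{M}\subseteq\mathrm{dom}(\mu)$ such that: (M1) $\mu(\emptyset)=0$; (M2) $\mu(X)>0$; (M3) $A\subseteq B$ implies $\mu(A)\leq\mu(B)$ for all $A,B\in\mathfrak{M}$; (M4) for every family $(A_i)_{i<\gamma}$ of pairwise disjoint sets of $\mathfrak{M}$ of length an ordinal $\gamma<\lambda^+$, we have $\langle\mu(A_i)\mid i<\gamma\rangle\in\mathrm{dom}(\mathsf{Sum})$ and $\mu(\bigcup_{i<\gamma}A_i)=\mathsf{Sum}(\langle\mu(A_i)\mid i<\gamma\rangle)$; (M5) for every $x\in X$ with $\{x\}\in\mathfrak{M}$ and every open local basis $\{A_i\mid i<\gamma\}$ at $x$ with $\gamma<\lambda^+$, $\mu(\{x\})=\inf_{i<\gamma}\mu(A_i)$. Then $(X,\mathfrak{M},\mu)$ is called a weak $\lambda^+$-measure space. It is continuous if $\{x\}\in\mathfrak{M}$ and $\mu(\{x\})=0$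 for every $x\in X$. -}

module Defs where

open import Level using (Level; _⊔_) renaming (suc to lsuc)
open import Algebra.Bundles using (RawMonoid)
open import Algebra.Structures using (IsMonoid)
import Algebra.Definitions.RawMonoid as MonoidSum
open import Data.Empty.Polymorphic using () renaming (⊥ to ⊥ₚ)
open import Data.Fin.Base as Fin using (Fin)
open import Data.Nat.Base using (ℕ; suc)
open import Data.Product.Base using (Σ-syntax; ∃-syntax; _×_; _,_; proj₁; proj₂)
open import Data.Sum.Base using (_⊎_)
open import Data.Unit.Polymorphic using () renaming (⊤ to ⊤ₚ)
open import Function.Base using (flip; _∘_)
open import Function.Bundles using (_↣_; module Injection)
open import Induction.WellFounded using (WellFounded)
open import Relation.Binary.Core using (Rel; _Preserves₂_⟶_⟶_)
open import Relation.Binary.Definitions using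
  (Irrelevant; Minimum; _Respects_; Trichotomous; tri<; tri≈; tri>)
open import Relation.Binary.Morphism.Structures using (IsOrderIsomorphism)
open import Relation.Binary.PropositionalEquality
  using (_≡_; _≢_; refl; sym; trans; cong; isEquivalence)
open import Relation.Binary.Structures using (IsStrictTotalOrder; IsTotalOrder)
import Relation.Binary.Construct.NonStrictToStrict as ToStrict
import Relation.Binary.Construct.On as On
open import Relation.Nullary.Negation.Core using (¬_)
open import Relation.Unary using (Pred; _∈_; _⊆_; _∩_; _⊥_; _≐_; ⋃; ｛_｝)

private
  variable
    ℓ a b r : Level

-- An ordinal is represented by a well-ordered type, which has to be thought
-- of up to order isomorphism; the types of `Set ℓ` play the role of the sets.
-- Proofs of _≺_ are unique, so that an initial segment, which is a Σ-type, has
-- the right cardinality.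
--
-- Set theory (ZFC) is modelled by Agda with excluded middle for all types, which
-- entails choice, and function extensionality, which makes _≡_ the right
-- equality of transfinite sequences; both are to be assumed as hypotheses.

record Ordinal (ℓ : Level) : Set (lsuc ℓ) where
  infix 4 _≺_ _≼_
  field
    Carrier            : Set ℓ
    _≺_                : Rel Carrier ℓ
    isStrictTotalOrder : IsStrictTotalOrder _≡_ _≺_
    ≺-irrelevant       : Irrelevant _≺_
    ≺-wellFounded      : WellFounded _≺_

  open IsStrictTotalOrder isStrictTotalOrder public
    using (compare) renaming (trans to ≺-trans)

  _≼_ : Rel Carrier ℓ
  α ≼ β = α ≺ β ⊎ α ≡ β

  Seg : Carrier → Set ℓ
  Seg α = Σ[ β ∈ Carrier ] β ≺ α

  IsLimit : Set ℓ
  IsLimit = Carrier × (∀ α → ∃[ β ] α ≺ β)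

open Ordinal using (Carrier; Seg; IsLimit)

OrderIso : (γ δ : Ordinal ℓ) → (Carrier γ → Carrier δ) → Set ℓ
OrderIso γ δ = IsOrderIsomorphism _≡_ _≡_ (Ordinal._≺_ γ) (Ordinal._≺_ δ)

module _ (γ : Ordinal ℓ) (α : Carrier γ) where
  open Ordinal γ hiding (Carrier; Seg; IsLimit)

  private
    seg≡ : {x y : Seg γ α} → proj₁ x ≡ proj₁ y → x ≡ y
    seg≡ {x , p} {.x , q} refl = cong (x ,_) (≺-irrelevant p q)

    _≺ₛ_ : Rel (Seg γ α) _
    x ≺ₛ y = proj₁ x ≺ proj₁ y

    segCompare : Trichotomous _≡_ _≺ₛ_
    segCompare x y with compare (proj₁ x) (proj₁ y)
    ... | tri< p ¬q ¬r = tri< p (¬q ∘ cong proj₁) ¬r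
    ... | tri≈ ¬p q ¬r = tri≈ ¬p (seg≡ q) ¬r
    ... | tri> ¬p ¬q r = tri> ¬p (¬q ∘ cong proj₁) r

  segment : Ordinal ℓ
  segment = record
    { Carrier            = Seg γ α
    ; _≺_                = _≺ₛ_
    ; isStrictTotalOrder = record
      { isStrictPartialOrder = record
        { isEquivalence = isEquivalence
        ; irrefl        = λ { refl → IsStrictTotalOrder.irrefl isStrictTotalOrder refl }
        ; trans         = ≺-trans
        ; <-resp-≈      = (λ { refl p → p }) , (λ { refl p → p })
        }
      ; compare = segCompare
      }
    ; ≺-irrelevant  = ≺-irrelevant
    ; ≺-wellFounded = On.wellFounded proj₁ ≺-wellFounded
    }

infix 4 _≤ᶜ_ _<ᶜ_

_≤ᶜ_ : Set a → Set b → Set _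
A ≤ᶜ B = A ↣ B

_<ᶜ_ : Set a → Set b → Set _
A <ᶜ B = A ≤ᶜ B × ¬ (B ≤ᶜ A)

-- An infinite initial ordinal.

record InfiniteCardinal (ℓ : Level) : Set (lsuc ℓ) where
  field
    ordinal  : Ordinal ℓ
    initial  : ∀ α → ¬ (Carrier ordinal ≤ᶜ Seg ordinal α)
    infinite : ℕ ≤ᶜ Carrier ordinal

  open Ordinal ordinal public

open InfiniteCardinal using (ordinal)

∣_∣ : InfiniteCardinal ℓ → Set ℓ
∣ κ ∣ = InfiniteCardinal.Carrier κ

-- No map from a smaller ordinal into κ is cofinal, i.e. cf(κ) = κ.

Regular : InfiniteCardinal ℓ → Set ℓ
Regular κ = ∀ α (f : K.Seg α → K.Carrier) → ¬ (∀ β → ∃[ i ] β K.≼ f i)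
  where module K = InfiniteCardinal κ

-- The ordinals γ < Λ⁺ are those of cardinality at most Λ.

_<⁺_ : Ordinal ℓ → InfiniteCardinal ℓ → Set ℓ
γ <⁺ Λ = Carrier γ ≤ᶜ ∣ Λ ∣

-- Partial functions as functional graphs. The relation _≈_ is the equality of
-- the domain: extensional equality for subsets, isomorphism for sequences.

record PartialFunction (A : Set a) (_≈_ : Rel A r) (B : Set b) (ℓ : Level)
                       : Set (a ⊔ r ⊔ b ⊔ lsuc ℓ) where
  field
    Graph      : A → B → Set ℓ
    respects   : ∀ {x y v} → x ≈ y → Graph x v → Graph y v
    functional : ∀ {x v w} → Graph x v → Graph x w → v ≡ w

infix 4 _⟦_⟧=_

_⟦_⟧=_ : {A : Set a} {_≈_ : Rel A r} {B : Set b} →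
         PartialFunction A _≈_ B ℓ → A → B → Set ℓ
_⟦_⟧=_ = PartialFunction.Graph

dom : {A : Set a} {_≈_ : Rel A r} {B : Set b} →
      PartialFunction A _≈_ B ℓ → Pred A _
dom f x = ∃[ v ] f ⟦ x ⟧= v

IsSup : {A : Set a} → Rel A r → Pred A b → Pred A _
IsSup _≤_ P v = (∀ p → P p → p ≤ v) × (∀ u → (∀ p → P p → p ≤ u) → v ≤ u)

IsInf : {A : Set a} → Rel A r → Pred A b → Pred A _
IsInf _≤_ = IsSup (flip _≤_)

record PositivelyTotallyOrderedMonoid (ℓ : Level) : Set (lsuc ℓ) where
  infixl 6 _+_
  infix 4 _≤_
  field
    S            : Set ℓ
    0#           : S
    _+_          : S → S → S
    _≤_          : Rel S ℓ
    isMonoid     : IsMonoid _≡_ _+_ 0#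
    isTotalOrder : IsTotalOrder _≡_ _≤_
    +-mono       : _+_ Preserves₂ _≤_ ⟶ _≤_ ⟶ _≤_
    0-minimum    : Minimum _≤_ 0#
    nontrivial   : ∃[ x ] x ≢ 0#

  rawMonoid : RawMonoid ℓ ℓ
  rawMonoid = record { Carrier = S ; _≈_ = _≡_ ; _∙_ = _+_ ; ε = 0# }

  open MonoidSum rawMonoid public using (sum)
  open ToStrict _≡_ _≤_ public using (_<_)

-- Sequences of ordinal length.

record Sequence (S : Set ℓ) : Set (lsuc ℓ) where
  constructor ⟨_,_⟩
  field
    lh   : Ordinal ℓ
    term : Carrier lh → S

open Sequence using (lh; term)

infix 4 _≅_
infixl 7 _↾_

_≅_ : {S : Set ℓ} → Sequence S → Sequence S → Set ℓ
s ≅ t = ∃[ e ] OrderIso (lh s) (lh t) e × (∀ i → term s i ≡ term t (e i))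

_↾_ : {S : Set ℓ} (s : Sequence S) → Carrier (lh s) → Sequence S
s ↾ α = ⟨ segment (lh s) α , term s ∘ proj₁ ⟩

record InfinitarySum {ℓ : Level} (𝕊 : PositivelyTotallyOrderedMonoid ℓ)
                     : Set (lsuc ℓ) where
  open PositivelyTotallyOrderedMonoid 𝕊
  field
    Sum        : PartialFunction (Sequence S) _≅_ S ℓ
    Sum-empty  : ∀ s → ¬ Carrier (lh s) → Sum ⟦ s ⟧= 0#
    Sum-finite : ∀ s n (e : Fin (suc n) → Carrier (lh s)) →
                 IsOrderIsomorphism _≡_ _≡_ Fin._<_ (Ordinal._≺_ (lh s)) e →
                 ∀ v → Sum ⟦ s ⟧= v → v ≡ sum (term s ∘ e)
    Sum-limit  : ∀ s v → IsLimit (lh s) → Sum ⟦ s ⟧= v →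
                 (∀ α → ∃[ β ] Ordinal._≼_ (lh s) α β × (s ↾ β) ∈ dom Sum) →
                 IsSup _≤_ (λ p → ∃[ α ] Sum ⟦ s ↾ α ⟧= p) v

-- The empty set and the whole space at level ℓ.

⊘ : {X : Set a} → Pred X ℓ
⊘ _ = ⊥ₚ

𝕌 : {X : Set a} → Pred X ℓ
𝕌 _ = ⊤ₚ

record Topology {ℓ : Level} (X : Set ℓ) : Set (lsuc ℓ) where
  field
    Open   : Pred (Pred X ℓ) ℓ
    Open-≐ : Open Respects _≐_
    Open-𝕌 : Open 𝕌
    Open-∩ : ∀ {U V} → Open U → Open V → Open (U ∩ V)
    Open-⋃ : (I : Set ℓ) (U : I → Pred X ℓ) → (∀ i → Open (U i)) → Open (⋃ I U)

-- Indexed families give all open local bases of size < Λ⁺, once γ < Λ⁺.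

record IsOpenLocalBasis {ℓ : Level} {X : Set ℓ} (T : Topology X) (x : X)
                        {I : Set ℓ} (A : I → Pred X ℓ) : Set (lsuc ℓ) where
  open Topology T
  field
    open-members : ∀ i → Open (A i)
    contains     : ∀ i → x ∈ A i
    basis        : ∀ U → Open U → x ∈ U → ∃[ i ] A i ⊆ U

record IsWeaklyMeasurable {ℓ : Level} (Λ : InfiniteCardinal ℓ) {X : Set ℓ}
                          (T : Topology X) (𝔐 : Pred (Pred X ℓ) ℓ)
                          : Set (lsuc ℓ) where
  field
    𝔐-≐    : 𝔐 Respects _≐_
    𝔐-⋃    : (I : Set ℓ) → I ≤ᶜ ∣ Λ ∣ → (A : I → Pred X ℓ) →
             (∀ i → A i ∈ 𝔐) → ⋃ I A ∈ 𝔐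
    open⊆𝔐 : Topology.Open T ⊆ 𝔐

record IsMeasure {ℓ : Level} (Λ : InfiniteCardinal ℓ) {X : Set ℓ}
                 (T : Topology X) (𝔐 : Pred (Pred X ℓ) ℓ)
                 (𝕊 : PositivelyTotallyOrderedMonoid ℓ) (σ : InfinitarySum 𝕊)
                 (μ : PartialFunction (Pred X ℓ) _≐_
                        (PositivelyTotallyOrderedMonoid.S 𝕊) ℓ)
                 : Set (lsuc ℓ) where
  open PositivelyTotallyOrderedMonoid 𝕊
  open InfinitarySum σ
  field
    𝔐⊆dom       : 𝔐 ⊆ dom μ
    empty       : μ ⟦ ⊘ ⟧= 0#
    positive    : ∃[ v ] μ ⟦ 𝕌 ⟧= v × 0# < v
    monotone    : ∀ A B → A ∈ 𝔐 → B ∈ 𝔐 → A ⊆ B →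
                  ∀ v w → μ ⟦ A ⟧= v → μ ⟦ B ⟧= w → v ≤ w
    additive    : (γ : Ordinal ℓ) → γ <⁺ Λ → (A : Carrier γ → Pred X ℓ) →
                  (∀ i → A i ∈ 𝔐) → (∀ i j → i ≢ j → A i ⊥ A j) →
                  (m : Carrier γ → S) → (∀ i → μ ⟦ A i ⟧= m i) →
                  ∃[ v ] Sum ⟦ ⟨ γ , m ⟩ ⟧= v × μ ⟦ ⋃ (Carrier γ) A ⟧= v
    point-value : ∀ x → ｛ x ｝ ∈ 𝔐 →
                  (γ : Ordinal ℓ) → γ <⁺ Λ → (A : Carrier γ → Pred X ℓ) →
                  IsOpenLocalBasis T x A →
                  ∀ v → μ ⟦ ｛ x ｝ ⟧= v →
                  IsInf _≤_ (λ p → ∃[ i ] μ ⟦ A i ⟧= p) v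

record WeakMeasureSpace {ℓ : Level} (Λ : InfiniteCardinal ℓ) {X : Set ℓ}
                        (T : Topology X)
                        (𝕊 : PositivelyTotallyOrderedMonoid ℓ)
                        (σ : InfinitarySum 𝕊) : Set (lsuc ℓ) where
  open PositivelyTotallyOrderedMonoid 𝕊 using (S; 0#)
  field
    𝔐                  : Pred (Pred X ℓ) ℓ
    isWeaklyMeasurable : IsWeaklyMeasurable Λ T 𝔐
    μ                  : PartialFunction (Pred X ℓ) _≐_ S ℓ
    isMeasure          : IsMeasure Λ T 𝔐 𝕊 σ μ

  IsContinuous : Set ℓ
  IsContinuous = ∀ x → ｛ x ｝ ∈ 𝔐 × μ ⟦ ｛ x ｝ ⟧= 0#

module _ (Λ κ : InfiniteCardinal ℓ) where
  private module K = InfiniteCardinal κ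

  _^_ : Set ℓ
  _^_ = ∣ κ ∣ → ∣ Λ ∣

  _^<_ : Set ℓ
  _^<_ = Σ[ α ∈ ∣ κ ∣ ] (K.Seg α → ∣ Λ ∣)

  Cone : _^<_ → Pred _^_ ℓ
  Cone (α , s) x = ∀ i → s i ≡ x (proj₁ i)

  -- The intersection of two cones is empty or one of the two, so the topology
  -- generated by the cones consists of the unions of cones.

  IsUnionOfCones : Pred (Pred _^_ ℓ) ℓ
  IsUnionOfCones U = ∀ x → x ∈ U → ∃[ s ] x ∈ Cone s × Cone s ⊆ U

  private
    meet : ∀ {x s t} → x ∈ Cone s → x ∈ Cone t →
           ∃[ u ] x ∈ Cone u × Cone u ⊆ Cone s × Cone u ⊆ Cone t
    meet {x} {α , s} {β , t} p q with K.compare α β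
    ... | tri< α≺β _ _ = (β , t) , q ,
            (λ y∈ (i , i≺α) → trans (p (i , i≺α)) (trans (sym (q (i , K.≺-trans i≺α α≺β))) (y∈ (i , K.≺-trans i≺α α≺β)))) ,
            (λ y∈ → y∈)
    ... | tri≈ _ refl _ = (α , s) , p , (λ y∈ → y∈) ,
            (λ y∈ i → trans (q i) (trans (sym (p i)) (y∈ i)))
    ... | tri> _ _ β≺α = (α , s) , p , (λ y∈ → y∈) ,
            (λ y∈ (i , i≺β) → trans (q (i , i≺β)) (trans (sym (p (i , K.≺-trans i≺β β≺α))) (y∈ (i , K.≺-trans i≺β β≺α))))

    point : ∣ κ ∣
    point = Injection.to K.infinite 0

  boundedTopology : Topology _^_
  boundedTopology = record
    { Open   = IsUnionOfCones
    ; Open-≐ = λ (U⊆V , V⊆U) oU x x∈V →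
        let s , x∈s , s⊆U = oU x (V⊆U x∈V) in s , x∈s , λ y∈ → U⊆V (s⊆U y∈)
    ; Open-𝕌 = λ x _ → (point , λ i → x (proj₁ i)) , (λ _ → refl) , _
    ; Open-∩ = λ oU oV x (x∈U , x∈V) →
        let s , x∈s , s⊆U = oU x x∈U
            t , x∈t , t⊆V = oV x x∈V
            u , x∈u , u⊆s , u⊆t = meet {s = s} {t} x∈s x∈t
        in u , x∈u , λ y∈ → s⊆U (u⊆s y∈) , t⊆V (u⊆t y∈)
    ; Open-⋃ = λ I U oU x (i , x∈Uᵢ) →
        let s , x∈s , s⊆Uᵢ = oU i x x∈Uᵢ in s , x∈s , λ y∈ → i , s⊆Uᵢ y∈
    }

{-# OPTIONS --safe #-}

-- Call a set small if it is covered by at most Λ cones of some fixed length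
-- α < κ, where α is chosen such that Λ ^ α > Λ. The small sets form a proper
-- ideal, closed under unions of size Λ because Λ × Λ ≤ Λ, and every point has a
-- small neighbourhood. So the two-valued function vanishing exactly on the small
-- sets is a continuous measure on the full power set, for the monoid {0 < 1}
-- with addition max and infinitary sum sup.

module Submission where

open import Defs
open import Level using (Level; Lift; lift; lower; _⊔_) renaming (suc to lsuc)
open import Axiom.ExcludedMiddle using (ExcludedMiddle)
open import Axiom.Extensionality.Propositional using (Extensionality; lower-extensionality)
open import Data.Empty.Polymorphic using () renaming (⊥ to ⊥ₚ)
open import Data.Fin.Base using (Fin; zero; suc; fromℕ<)
open import Data.Fin.Properties using (+↔⊎; *↔×; 1↔⊤; fromℕ<-injective; ℕ→Fin-notInjective)
open import Data.Nat.Base as ℕ using (ℕ)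
open import Data.Nat.Induction using (<-wellFounded)
open import Data.Nat.Properties using (<-cmp)
open import Data.Product.Base using (Σ-syntax; ∃-syntax; _×_; _,_; proj₁; proj₂)
open import Data.Product.Function.NonDependent.Propositional using (_×-↣_)
open import Data.Product.Relation.Binary.Lex.Strict using (×-Lex; ×-wellFounded; ×-compare)
open import Data.Product.Relation.Binary.Pointwise.NonDependent using (≡×≡⇒≡)
open import Data.Sum.Base using (_⊎_; inj₁; inj₂)
open import Data.Sum.Function.Propositional using (_⊎-↣_)
open import Data.Unit.Base using (⊤; tt)
open import Data.Unit.Polymorphic using () renaming (⊤ to ⊤ₚ)
open import Function.Base using (_∘_; _on_)
open import Function.Bundles using (_↣_; mk↣; module Injection)
open import Function.Construct.Composition using () renaming (_↣-∘_ to infixr 8 _↣-∘_)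
open import Function.Construct.Identity using (↣-id)
open import Function.Construct.Symmetry using (↔-sym)
open import Function.Properties.Inverse using (↔⇒↣)
open import Induction.WellFounded using (WellFounded; module All; module FixPoint)
open import Relation.Binary.Core using (Rel)
open import Relation.Binary.Definitions using (Trichotomous; Tri; tri<; tri≈; tri>)
open import Relation.Binary.Morphism.Structures using (IsOrderIsomorphism)
open import Relation.Binary.PropositionalEquality
  using (_≡_; _≢_; refl; sym; trans; cong; cong₂; subst; isEquivalence)
import Relation.Binary.Construct.On as On
open import Relation.Nullary.Decidable.Core using (Dec; yes; no; map′; decidable-stable)
open import Relation.Nullary.Negation.Core using (¬_; contradiction)
open import Relation.Unary using (Pred; _⊆_; _≐_; ⋃; ｛_｝)

open Injection using (to; injective)

private
  variable
    a p w ℓ : Level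

-- Consequences of excluded middle

lower-excludedMiddle : ExcludedMiddle (lsuc ℓ) → ExcludedMiddle ℓ
lower-excludedMiddle {ℓ} em {P} = map′ lower lift (em {Lift (lsuc ℓ) P})

-- Where `B x` carries data, stability under double negation also selects an element of each `B x`,
-- so the contraposition contains a use of choice.
¬∀⇒∃¬ : {A : Set a} {B : A → Set p} → ExcludedMiddle (a ⊔ p) → ExcludedMiddle p →
        ¬ (∀ x → B x) → ∃[ x ] ¬ B x
¬∀⇒∃¬ em em′ ¬∀ = decidable-stable em λ ¬∃ →
  ¬∀ λ x → decidable-stable em′ λ ¬B → ¬∃ (x , ¬B)

-- Comparison of a well-ordered set with an arbitrary set

-- Fresh values in W are chosen along P for as long as there are any.

comparable : {P : Set p} {W : Set w} {_<_ : Rel P p} →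
             ExcludedMiddle (p ⊔ w) → Extensionality p w →
             WellFounded _<_ → Trichotomous _≡_ _<_ →
             P ↣ W ⊎ (∃[ x ] Σ[ h ∈ W ↣ P ] ∀ v → to h v < x)
comparable {p} {w} {P} {W} {_<_} em ext wf compare
  with em {∃[ x ] Σ[ h ∈ W ↣ P ] ∀ v → to h v < x}
... | yes exhausted = inj₂ exhausted
... | no ¬exhausted = inj₁ (mk↣ (f-injective (compare _ _)))
  where
  Below : P → Set p
  Below x = ∃[ y ] y < x

  -- Proofs of _<_ need not be unique, so one of them is singled out.
  canonical : ∀ {x} → Below x → Below x
  canonical {x} (y , y<x) with compare y x
  ... | tri< y<x′ _ _ = y , y<x′
  ... | tri≈ ¬y<x _ _ = contradiction y<x ¬y<x
  ... | tri> ¬y<x _ _ = contradiction y<x ¬y<x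

  canonical-proj₁ : ∀ {x} (q : Below x) → proj₁ (canonical q) ≡ proj₁ q
  canonical-proj₁ {x} (y , y<x) with compare y x
  ... | tri< _ _ _    = refl
  ... | tri≈ ¬y<x _ _ = contradiction y<x ¬y<x
  ... | tri> ¬y<x _ _ = contradiction y<x ¬y<x

  canonical-unique : ∀ {x} (q r : Below x) → proj₁ q ≡ proj₁ r → canonical q ≡ canonical r
  canonical-unique {x} (y , y<x) (.y , y<x′) refl with compare y x
  ... | tri< _ _ _    = refl
  ... | tri≈ ¬y<x _ _ = contradiction y<x ¬y<x
  ... | tri> ¬y<x _ _ = contradiction y<x ¬y<x

  -- If every value were hit, choosing preimages would inject `W` into the part of `P` below `x`,
  -- against `¬exhausted`. The earlier values form one function on pairs so that a single use of
  -- `ext` proves `f-unfold`.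
  fresh : ∀ x (g : Below x → W) → ∃[ v ] ∀ q → g (canonical q) ≢ v
  fresh x g = decidable-stable em λ none →
    let preimage : ∀ v → ∃[ q ] g (canonical q) ≡ v
        preimage v = decidable-stable em λ ¬q → none (v , λ q gq≡v → ¬q (q , gq≡v))
        q : W → Below x
        q v = proj₁ (preimage v)
        q-injective : ∀ {v v′} → proj₁ (q v) ≡ proj₁ (q v′) → v ≡ v′
        q-injective {v} {v′} eq = trans (sym (proj₂ (preimage v)))
          (trans (cong g (canonical-unique (q v) (q v′) eq)) (proj₂ (preimage v′)))
    in ¬exhausted (x , mk↣ q-injective , λ v → proj₂ (q v))

  step : ∀ x → (∀ {y} → y < x → W) → W
  step x f<x = proj₁ (fresh x λ q → f<x (proj₂ q))

  f : P → W
  f = All.wfRec wf w (λ _ → W) step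

  f-unfold : ∀ {x} → f x ≡ step x (λ {y} _ → f y)
  f-unfold = FixPoint.unfold-wfRec wf (λ _ → W) step
    λ x eq → cong (λ g → proj₁ (fresh x g)) (ext λ q → eq (proj₂ q))

  f-fresh : ∀ {x y} → y < x → f y ≢ f x
  f-fresh {x} {y} y<x fy≡fx = proj₂ (fresh x λ q → f (proj₁ q)) (y , y<x)
    (trans (cong f (canonical-proj₁ (y , y<x))) (trans fy≡fx f-unfold))

  -- A with-abstraction would normalise f x, which is slow.
  f-injective : ∀ {x y} → Tri (x < y) (x ≡ y) (y < x) → f x ≡ f y → x ≡ y
  f-injective (tri< x<y _ _) eq = contradiction eq (f-fresh x<y)
  f-injective (tri≈ _ x≡y _) _  = x≡y
  f-injective (tri> _ _ y<x) eq = contradiction (sym eq) (f-fresh y<x)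

-- This is `comparable` along ℕ: if the fresh values run out at stage `n`, then `A` embeds into the
-- numbers below `n`.
finite-or-infinite : (A : Set ℓ) → ExcludedMiddle ℓ → Extensionality ℓ ℓ →
                     ℕ ↣ A ⊎ ∃[ n ] A ↣ Fin n
finite-or-infinite {ℓ} A em ext
  with comparable {W = A} em (lower-extensionality ℓ ℓ ext) <-wellFounded <-cmp
... | inj₁ ℕ↣A           = inj₁ ℕ↣A
... | inj₂ (n , h , h<n) = inj₂ (n , mk↣ {to = λ v → fromℕ< (h<n v)}
        λ eq → injective h (fromℕ<-injective _ _ (h<n _) (h<n _) eq))

ℕ↣̸Fin : ∀ {n} → ¬ (ℕ ↣ Fin n)
ℕ↣̸Fin h = ℕ→Fin-notInjective (to h) (injective h)

-- Canonical well-ordering of W × W: pairs are compared by their maximum first.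

module _ (W : Ordinal ℓ) where
  open Ordinal W

  ≼-join : ∀ x y → ∃[ m ] x ≼ m × y ≼ m
  ≼-join x y with compare x y
  ... | tri< x≺y _ _ = y , inj₁ x≺y , inj₂ refl
  ... | tri≈ _ x≡y _ = y , inj₂ x≡y , inj₂ refl
  ... | tri> _ _ y≺x = x , inj₂ refl , inj₁ y≺x

  ≼-trans : ∀ {x y z} → x ≼ y → y ≼ z → x ≼ z
  ≼-trans (inj₁ x≺y)  (inj₁ y≺z)  = inj₁ (≺-trans x≺y y≺z)
  ≼-trans (inj₁ x≺y)  (inj₂ refl) = inj₁ x≺y
  ≼-trans (inj₂ refl) y≼z         = y≼z

  private
    join : Carrier × Carrier → Carrier
    join (x , y) = proj₁ (≼-join x y)

    -- Repeating the pair after its maximum makes `key` injective, so the lexicographic order pulled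
    -- back along it stays trichotomous.
    key : Carrier × Carrier → Carrier × (Carrier × Carrier)
    key q = join q , q

    _≺²_ : Rel (Carrier × Carrier) ℓ
    _≺²_ = ×-Lex _≡_ _≺_ _≺_

    _⊏_ : Rel (Carrier × Carrier) ℓ
    _⊏_ = ×-Lex _≡_ _≺_ _≺²_ on key

    ⊏-wellFounded : WellFounded _⊏_
    ⊏-wellFounded = On.wellFounded key
      (×-wellFounded ≺-wellFounded (×-wellFounded ≺-wellFounded ≺-wellFounded))

    ⊏-compare : Trichotomous _≡_ _⊏_
    ⊏-compare q r with ×-compare sym compare (×-compare sym compare compare) (key q) (key r)
    ... | tri< q⊏r q≉r q⋣r = tri< q⊏r (λ { refl → q≉r (refl , refl , refl) }) q⋣r
    ... | tri≈ q⋢r q≈r q⋣r = tri≈ q⋢r (≡×≡⇒≡ (proj₂ q≈r)) q⋣r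
    ... | tri> q⋢r q≉r q⊐r = tri> q⋢r (λ { refl → q≉r (refl , refl , refl) }) q⊐r

    ⊏⇒≼ : ∀ {q r} → q ⊏ r → join q ≼ join r
    ⊏⇒≼ (inj₁ lt)       = inj₁ lt
    ⊏⇒≼ (inj₂ (eq , _)) = inj₂ eq

    -- The closed segment up to `m`, with `⊤` standing for `m` itself.
    fromClosed : ∀ {m x} → x ≼ m → Seg m ⊎ ⊤
    fromClosed (inj₁ x≺m) = inj₁ (_ , x≺m)
    fromClosed (inj₂ _)   = inj₂ tt

    fromClosed-injective : ∀ {m x y} (p : x ≼ m) (q : y ≼ m) →
                           fromClosed p ≡ fromClosed q → x ≡ y
    fromClosed-injective (inj₁ _)    (inj₁ _)    refl = refl
    fromClosed-injective (inj₂ refl) (inj₂ refl) _    = refl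

  -- A pair preceding `m` has maximum at most `join m`, so both of its coordinates lie in the closed
  -- segment up to `join m`.
  below-canonical : {A : Set a} (m : Carrier × Carrier) (h : A ↣ (Carrier × Carrier)) →
                    (∀ v → to h v ⊏ m) → let c = join m in A ↣ ((Seg c ⊎ ⊤) × (Seg c ⊎ ⊤))
  below-canonical m h h⊏m = mk↣ {to = λ v → fromClosed (left v) , fromClosed (right v)}
    λ {v} {v′} eq → injective h (cong₂ _,_
      (fromClosed-injective (left v) (left v′) (cong proj₁ eq))
      (fromClosed-injective (right v) (right v′) (cong proj₂ eq)))
    where
    left : ∀ v → proj₁ (to h v) ≼ join m
    left v = ≼-trans (proj₁ (proj₂ (≼-join _ _))) (⊏⇒≼ (h⊏m v))
    right : ∀ v → proj₂ (to h v) ≼ join m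
    right v = ≼-trans (proj₂ (proj₂ (≼-join _ _))) (⊏⇒≼ (h⊏m v))

  square-comparable : {A : Set ℓ} → ExcludedMiddle ℓ → Extensionality ℓ ℓ →
                      (Carrier × Carrier) ↣ A ⊎ ∃[ m ] A ↣ ((Seg m ⊎ ⊤) × (Seg m ⊎ ⊤))
  square-comparable em ext with comparable em ext ⊏-wellFounded ⊏-compare
  ... | inj₁ W²↣A          = inj₁ W²↣A
  ... | inj₂ (m , h , h⊏m) = inj₂ (join m , below-canonical m h h⊏m)

-- Squares of infinite well-ordered sets

square : Set a → Set a
square A = A × A

square-mono : {A : Set a} {B : Set p} → A ↣ B → square A ↣ square B
square-mono h = h ×-↣ h

-- Two distinct elements of `A`, the images of 0 and 1, serve as tags for the two summands.
⊎⊤↣square : {A : Set a} → ℕ ↣ A → (A ⊎ ⊤) ↣ square A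
⊎⊤↣square {A = A} h = mk↣ {to = code} code-injective
  where
  code : A ⊎ ⊤ → square A
  code (inj₁ x)  = to h 0 , x
  code (inj₂ tt) = to h 1 , to h 0

  code-injective : ∀ {x y} → code x ≡ code y → x ≡ y
  code-injective {inj₁ _}  {inj₁ _}  eq = cong inj₁ (cong proj₂ eq)
  code-injective {inj₁ _}  {inj₂ tt} eq with () ← injective h (cong proj₁ eq)
  code-injective {inj₂ tt} {inj₁ _}  eq with () ← injective h (cong proj₁ eq)
  code-injective {inj₂ tt} {inj₂ tt} _  = refl

-- If W does not inject into an initial segment, it cannot inject into a segment
-- of the canonical well-ordering either, as that lies in the square of one.

square-step : ExcludedMiddle ℓ → Extensionality ℓ ℓ → (W : Ordinal ℓ) → let open Ordinal W in
              (∀ m → ℕ ↣ Seg m → square (Seg m) ↣ Seg m) →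
              ℕ ↣ Carrier → square Carrier ↣ Carrier
square-step em ext W IH ℕ↣W with em {∃[ m ] Ordinal.Carrier W ↣ Ordinal.Seg W m}
-- If `W` injects into one of its segments, the claim is inherited from that segment.
... | yes (m , h) = mk↣ proj₁-injective ↣-∘ IH m (h ↣-∘ ℕ↣W) ↣-∘ square-mono h
  where
  open Ordinal W
  proj₁-injective : {x y : Seg m} → proj₁ x ≡ proj₁ y → x ≡ y
  proj₁-injective {x , _} refl = cong (x ,_) (≺-irrelevant _ _)
... | no initial with square-comparable W em ext
...   | inj₁ W²↣W    = W²↣W
...   | inj₂ (m , h) with finite-or-infinite (Ordinal.Seg W m) em ext
-- An infinite segment absorbs one more point and then the square, so `W` would inject into `Seg m`.
...     | inj₁ ℕ↣m = contradiction
            (m , m²↣m ↣-∘ square-mono (m²↣m ↣-∘ ⊎⊤↣square ℕ↣m) ↣-∘ h) initial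
  where m²↣m = IH m ℕ↣m
-- The square of a finite segment with one more point is finite, whereas ℕ injects into `W`.
...     | inj₂ (n , m↣n) = contradiction
            (↔⇒↣ (↔-sym *↔×) ↣-∘ square-mono (↔⇒↣ (↔-sym +↔⊎) ↣-∘ (m↣n ⊎-↣ ↔⇒↣ (↔-sym 1↔⊤))) ↣-∘ h ↣-∘ ℕ↣W)
            ℕ↣̸Fin

-- Well-founded induction settles all segments, and one further `square-step` passes from them to
-- `W`. A segment of `segment W m` is a nested Σ-type, so `into` and `from` identify it with a
-- segment of `W`.
infinite⇒square↣ : ExcludedMiddle ℓ → Extensionality ℓ ℓ → (W : Ordinal ℓ) → let open Ordinal W in
                   ℕ ↣ Carrier → square Carrier ↣ Carrier
infinite⇒square↣ {ℓ} em ext W = square-step em ext W λ m →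
  All.wfRec ≺-wellFounded ℓ (λ m → ℕ ↣ Seg m → square (Seg m) ↣ Seg m)
    (λ m IH → square-step em ext (segment W m) λ (x , x≺m) ℕ↣x →
      from x≺m ↣-∘ IH x≺m (into x≺m ↣-∘ ℕ↣x) ↣-∘ square-mono (into x≺m)) m
  where
  open Ordinal W

  into : ∀ {m x} (x≺m : x ≺ m) → Ordinal.Seg (segment W m) (x , x≺m) ↣ Seg x
  into x≺m = mk↣ {to = λ ((y , _) , y≺x) → y , y≺x}
    λ { {(y , p) , q} {(.y , p′) , .q} refl → cong (λ p → (y , p) , q) (≺-irrelevant p p′) }

  from : ∀ {m x} (x≺m : x ≺ m) → Seg x ↣ Ordinal.Seg (segment W m) (x , x≺m)
  from x≺m = mk↣ {to = λ (y , y≺x) → (y , ≺-trans y≺x x≺m) , y≺x} λ { refl → refl }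

-- Extension of functions along injections

-- Off the image of `e` the value is the default `d`. The decision is an explicit argument of
-- `extend`, which lets `g-extends` treat all decisions at once.
extend-along : {A B C : Set ℓ} → ExcludedMiddle ℓ → (e : A ↣ B) → C → (f : A → C) →
               ∃[ g ] ∀ x → g (to e x) ≡ f x
extend-along {ℓ} {A} {B} {C} em e d f = g , λ x → g-extends x em
  where
  extend : ∀ y → Dec (∃[ x ] to e x ≡ y) → C
  extend y (yes (x , _)) = f x
  extend y (no _)        = d

  g : B → C
  g y = extend y em

  g-extends : ∀ x (∈im? : Dec (∃[ x′ ] to e x′ ≡ to e x)) → extend (to e x) ∈im? ≡ f x
  g-extends x (yes (_ , eq)) = cong f (injective e eq)
  g-extends x (no ∉im)       = contradiction (x , refl) ∉im

-- The monoid {0 < 1}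

data Two (ℓ : Level) : Set ℓ where
  0ₜ 1ₜ : Two ℓ

private
  infixl 6 _+_
  infix 4 _≤_

  _+_ : Two ℓ → Two ℓ → Two ℓ
  0ₜ + y = y
  1ₜ + y = 1ₜ

  _≤_ : Rel (Two ℓ) ℓ
  0ₜ ≤ _  = ⊤ₚ
  1ₜ ≤ 0ₜ = ⊥ₚ
  1ₜ ≤ 1ₜ = ⊤ₚ

  ≤-refl : (x : Two ℓ) → x ≤ x
  ≤-refl 0ₜ = _
  ≤-refl 1ₜ = _

  ≤-trans : (x y z : Two ℓ) → x ≤ y → y ≤ z → x ≤ z
  ≤-trans 0ₜ _  _  _ _ = _
  ≤-trans 1ₜ 1ₜ 1ₜ _ _ = _

  ≤-antisym : (x y : Two ℓ) → x ≤ y → y ≤ x → x ≡ y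
  ≤-antisym 0ₜ 0ₜ _ _ = refl
  ≤-antisym 1ₜ 1ₜ _ _ = refl

  ≤-total : (x y : Two ℓ) → x ≤ y ⊎ y ≤ x
  ≤-total 0ₜ _  = inj₁ _
  ≤-total 1ₜ 0ₜ = inj₂ _
  ≤-total 1ₜ 1ₜ = inj₁ _

  ≤-maximum : (x : Two ℓ) → x ≤ 1ₜ
  ≤-maximum 0ₜ = _
  ≤-maximum 1ₜ = _

  +-identityʳ : (x : Two ℓ) → x + 0ₜ ≡ x
  +-identityʳ 0ₜ = refl
  +-identityʳ 1ₜ = refl

  +-assoc : (x y z : Two ℓ) → (x + y) + z ≡ x + (y + z)
  +-assoc 0ₜ _ _ = refl
  +-assoc 1ₜ _ _ = refl

  x≤x+y : (x y : Two ℓ) → x ≤ x + y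
  x≤x+y 0ₜ _ = _
  x≤x+y 1ₜ _ = _

  y≤x+y : (x y : Two ℓ) → y ≤ x + y
  y≤x+y 0ₜ y = ≤-refl y
  y≤x+y 1ₜ y = ≤-maximum y

  -- With the two preceding bounds this makes `_+_` the binary join; monotonicity of `_+_` and the
  -- agreement of finite sums with suprema rest on it.
  +-lub : (x y u : Two ℓ) → x ≤ u → y ≤ u → x + y ≤ u
  +-lub 0ₜ _ _ _   y≤u = y≤u
  +-lub 1ₜ _ _ 1≤u _   = 1≤u

  +-mono : {x x′ y y′ : Two ℓ} → x ≤ x′ → y ≤ y′ → x + y ≤ x′ + y′
  +-mono {x = x} {x′} {y} {y′} x≤x′ y≤y′ = +-lub x y (x′ + y′)
    (≤-trans x x′ (x′ + y′) x≤x′ (x≤x+y x′ y′)) (≤-trans y y′ (x′ + y′) y≤y′ (y≤x+y x′ y′))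

two : ∀ ℓ → PositivelyTotallyOrderedMonoid ℓ
two ℓ = record
  { S = Two ℓ ; 0# = 0ₜ ; _+_ = _+_ ; _≤_ = _≤_
  ; isMonoid = record
    { isSemigroup = record
      { isMagma = record { isEquivalence = isEquivalence ; ∙-cong = cong₂ _+_ }
      ; assoc   = +-assoc
      }
    ; identity = (λ _ → refl) , +-identityʳ
    }
  ; isTotalOrder = record
    { isPartialOrder = record
      { isPreorder = record
        { isEquivalence = isEquivalence
        ; reflexive     = λ { {x} refl → ≤-refl x }
        ; trans         = λ {x} {y} {z} → ≤-trans x y z
        }
      ; antisym = λ {x} {y} → ≤-antisym x y
      }
    ; total = ≤-total
    }
  ; +-mono     = λ {x} → +-mono {x = x}
  ; 0-minimum  = _
  ; nontrivial = 1ₜ , λ ()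
  }

-- Suprema in {0 < 1} and the infinitary sum

private
  Range : {I : Set ℓ} → (I → Two ℓ) → Pred (Two ℓ) ℓ
  Range t p = ∃[ i ] t i ≡ p

  sup-unique : {P : Pred (Two ℓ) ℓ} {v w : Two ℓ} → IsSup _≤_ P v → IsSup _≤_ P w → v ≡ w
  sup-unique {v = v} {w} (P≤v , v-least) (P≤w , w-least) =
    ≤-antisym v w (v-least w P≤w) (w-least v P≤v)

  sup-≐ : {P Q : Pred (Two ℓ) ℓ} {v : Two ℓ} → P ≐ Q → IsSup _≤_ P v → IsSup _≤_ Q v
  sup-≐ (P⊆Q , Q⊆P) (P≤v , v-least) =
    (λ p Qp → P≤v p (Q⊆P Qp)) , λ u Q≤u → v-least u λ p Pp → Q≤u p (P⊆Q Pp)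

  -- The supremum is 1 exactly when 1 belongs to `P`; excluded middle decides this, so every
  -- sequence has a sum.
  sup-exists : ExcludedMiddle ℓ → (P : Pred (Two ℓ) ℓ) → ∃[ v ] IsSup _≤_ P v
  sup-exists em P with em {P 1ₜ}
  ... | yes P1 = 1ₜ , (λ p _ → ≤-maximum p) , λ u P≤u → P≤u 1ₜ P1
  ... | no ¬P1 = 0ₜ , (λ { 0ₜ _ → _ ; 1ₜ P1 → contradiction P1 ¬P1 }) , _

  sum-isSup : ∀ {n} (t : Fin n → Two ℓ) →
              IsSup _≤_ (λ p → ∃[ i ] t i ≡ p) (PositivelyTotallyOrderedMonoid.sum (two ℓ) t)
  sum-isSup {n = ℕ.zero}  t = (λ { _ (() , _) }) , _
  sum-isSup {n = ℕ.suc n} t with sum-isSup (t ∘ suc)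
  ... | t≤Σ , Σ-least =
    (λ { _ (zero , refl) → x≤x+y (t zero) _
       ; _ (suc i , refl) → ≤-trans (t (suc i)) _ (t zero + _) (t≤Σ _ (i , refl)) (y≤x+y (t zero) _) }) ,
    λ u t≤u → +-lub (t zero) _ u (t≤u _ (zero , refl))
      (Σ-least u λ { _ (i , refl) → t≤u _ (suc i , refl) })

supremum : ExcludedMiddle ℓ → InfinitarySum (two ℓ)
supremum {ℓ} em = record
  { Sum = record
    { Graph      = λ s → IsSup _≤_ (Range (Sequence.term s))
    ; respects   = λ {s} {t} (e , iso , s≡t∘e) → sup-≐
        ( (λ { (i , refl) → e i , sym (s≡t∘e i) })
        , (λ { (j , refl) → let i , ei≡j = IsOrderIsomorphism.surjective iso j in
                 i , trans (s≡t∘e i) (cong (Sequence.term t) (ei≡j refl)) }) )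
    ; functional = sup-unique
    }
  ; Sum-empty  = λ s ∅ → (λ { _ (i , _) → contradiction i ∅ }) , _
  ; Sum-finite = λ s n e iso v v-sup → sup-unique v-sup (sup-≐
        ( (λ { (i , eq) → e i , eq })
        , (λ { (j , refl) → let i , ei≡j = IsOrderIsomorphism.surjective iso j in
                 i , cong (Sequence.term s) (ei≡j refl) }) )
        (sum-isSup (Sequence.term s ∘ e)))
  ; Sum-limit  = λ s v (_ , limit) (s≤v , v-least) _ →
      (λ p (α , _ , p-least) → p-least v λ { q ((i , _) , eq) → s≤v q (i , eq) }) ,
      -- At limit length each index `i` lies below some `β`, and the partial sum up to `β` already
      -- bounds the term at `i`.
      λ u sums≤u → v-least u λ { _ (i , refl) →
        let β , i≺β = limit i
            q , q-sup = sup-exists em (Range (Sequence.term (s ↾ β)))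
        in ≤-trans (Sequence.term s i) q u
             (proj₁ q-sup _ ((i , i≺β) , refl)) (sums≤u q (β , q-sup)) }
  }

-- The ideal of small sets

-- Otherwise injections `h α` of all the powers into Λ could be combined: sending a pair of `α` and
-- `s` to `α` and the code of `s` embeds `Λ ^< κ` into κ × Λ, hence into Λ × Λ and into Λ.
∃-large-exponent : ExcludedMiddle ℓ → Extensionality ℓ ℓ →
                   (κ Λ : InfiniteCardinal ℓ) → ∣ κ ∣ ≤ᶜ ∣ Λ ∣ → ¬ ((Λ ^< κ) ≤ᶜ ∣ Λ ∣) →
                   ∃[ α ] ¬ ((InfiniteCardinal.Seg κ α → ∣ Λ ∣) ≤ᶜ ∣ Λ ∣)
∃-large-exponent em ext κ Λ κ≤Λ Λ^<κ≰Λ = ¬∀⇒∃¬ em em λ h → Λ^<κ≰Λ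
  (infinite⇒square↣ em ext Λ.ordinal Λ.infinite ↣-∘ (κ≤Λ ×-↣ ↣-id _) ↣-∘
   mk↣ {to = λ (α , s) → α , to (h α) s} (encode-injective h))
  where
  module Λ = InfiniteCardinal Λ
  module K = InfiniteCardinal κ
  encode-injective : (h : ∀ α → (K.Seg α → ∣ Λ ∣) ↣ ∣ Λ ∣) {x y : Λ ^< κ} →
                     (proj₁ x , to (h (proj₁ x)) (proj₂ x)) ≡ (proj₁ y , to (h (proj₁ y)) (proj₂ y)) → x ≡ y
  encode-injective h {α , s} {β , t} eq with refl ← cong proj₁ eq =
    cong (α ,_) (injective (h α) (cong proj₂ eq))

module _ {ℓ} (em : ExcludedMiddle ℓ) (ext : Extensionality ℓ ℓ) (κ Λ : InfiniteCardinal ℓ)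
         (α : ∣ κ ∣) where
  private
    module K = InfiniteCardinal κ
    module L = InfiniteCardinal Λ

    X : Set ℓ
    X = Λ ^ κ

    origin : L.Carrier
    origin = to L.infinite 0

  -- Repetitions in `c` are allowed, which gives covers by at most Λ cones. The cover is kept as
  -- data, so a family of small sets comes with chosen covers.
  Small : Pred (Pred X ℓ) ℓ
  Small A = Σ[ c ∈ (∣ Λ ∣ → K.Seg α → ∣ Λ ∣) ] A ⊆ ⋃ ∣ Λ ∣ (λ i → Cone Λ κ (α , c i))

  small-⊆ : ∀ {A B} → A ⊆ B → Small B → Small A
  small-⊆ A⊆B (c , B⊆c) = c , λ x∈A → B⊆c (A⊆B x∈A)

  small-cone : ∀ s → Small (Cone Λ κ (α , s))
  small-cone s = (λ _ → s) , λ x∈ → origin , x∈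

  -- The cones of all the covers are indexed by `I` × Λ and are reindexed by Λ through `code`;
  -- indices outside its image receive an arbitrary cone, which does not harm a cover.
  small-⋃ : {I : Set ℓ} → I ≤ᶜ ∣ Λ ∣ → (A : I → Pred X ℓ) → (∀ i → Small (A i)) → Small (⋃ I A)
  small-⋃ {I} I≤Λ A small =
    let c , c-extends = extend-along em code (λ _ → origin) (λ (i , j) → proj₁ (small i) j)
    in c , λ {x} (i , x∈Aᵢ) → let j , x∈cone = proj₂ (small i) x∈Aᵢ in
      to code (i , j) , subst (λ s → Cone Λ κ (α , s) x) (sym (c-extends (i , j))) x∈cone
    where
    code : (I × ∣ Λ ∣) ↣ ∣ Λ ∣
    code = infinite⇒square↣ em ext L.ordinal L.infinite ↣-∘ (I≤Λ ×-↣ ↣-id _)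

  -- Extend each `s` to a point of the space and take the index of a cone containing it. That point
  -- restricts both to `s` and to the stem of the cone, so the index determines `s`, and Λ ^ α would
  -- inject into Λ.
  space-not-small : ¬ ((K.Seg α → ∣ Λ ∣) ≤ᶜ ∣ Λ ∣) → ¬ Small 𝕌
  space-not-small Λ^α≰Λ (c , cover) = Λ^α≰Λ (mk↣ {to = index}
    λ {s} {t} eq → trans (sym (c-index s)) (trans (cong c eq) (c-index t)))
    where
    Seg↣κ : K.Seg α ↣ ∣ κ ∣
    Seg↣κ = mk↣ {to = proj₁} λ { {x , _} refl → cong (x ,_) (K.≺-irrelevant _ _) }

    point : (s : K.Seg α → ∣ Λ ∣) → ∃[ x ] ∀ i → x (proj₁ i) ≡ s i
    point = extend-along em Seg↣κ origin

    index : (K.Seg α → ∣ Λ ∣) → ∣ Λ ∣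
    index s = proj₁ (cover {proj₁ (point s)} _)

    c-index : ∀ s → c (index s) ≡ s
    c-index s = ext λ i → trans (proj₂ (cover {proj₁ (point s)} _) i) (proj₂ (point s) i)

  -- The measure vanishing on the small sets

  private
    μ-Graph : Pred X ℓ → Two ℓ → Set ℓ
    μ-Graph A 0ₜ = Small A
    μ-Graph A 1ₜ = ¬ Small A

    μ-respects : ∀ {A B v} → A ≐ B → μ-Graph A v → μ-Graph B v
    μ-respects {v = 0ₜ} (_ , B⊆A) small  = small-⊆ B⊆A small
    μ-respects {v = 1ₜ} (A⊆B , _) ¬small = ¬small ∘ small-⊆ A⊆B

    μ-functional : ∀ {A v w} → μ-Graph A v → μ-Graph A w → v ≡ w
    μ-functional {v = 0ₜ} {0ₜ} _      _      = refl
    μ-functional {v = 0ₜ} {1ₜ} small  ¬small = contradiction small ¬small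
    μ-functional {v = 1ₜ} {0ₜ} ¬small small  = contradiction small ¬small
    μ-functional {v = 1ₜ} {1ₜ} _      _      = refl

    μ-total : ∀ A → ∃[ v ] μ-Graph A v
    μ-total A with em {Small A}
    ... | yes small = 0ₜ , small
    ... | no ¬small = 1ₜ , ¬small

    μ-monotone : ∀ {A B} → A ⊆ B → ∀ v w → μ-Graph A v → μ-Graph B w → v ≤ w
    μ-monotone A⊆B 0ₜ _  _      _     = _
    μ-monotone A⊆B 1ₜ 0ₜ ¬small small = contradiction (small-⊆ A⊆B small) ¬small
    μ-monotone A⊆B 1ₜ 1ₜ _      _     = _

    μ-additive : {I : Set ℓ} → I ≤ᶜ ∣ Λ ∣ → (A : I → Pred X ℓ) (m : I → Two ℓ) →
                 (∀ i → μ-Graph (A i) (m i)) →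
                 ∃[ v ] IsSup _≤_ (Range m) v × μ-Graph (⋃ I A) v
    μ-additive {I} I≤Λ A m μA≡m with μ-total (⋃ I A)
    ... | v , μ⋃≡v = v ,
      ( (λ { _ (i , refl) → μ-monotone (i ,_) (m i) v (μA≡m i) μ⋃≡v })
      , λ { 1ₜ _ → ≤-maximum v
          -- An upper bound 0 makes every `A i` small, hence the union is small and its value `v` is
          -- at most 0.
          ; 0ₜ m≤0 → μ-monotone (λ x∈ → x∈) v 0ₜ μ⋃≡v
              (small-⋃ I≤Λ A λ i → small (m i) (μA≡m i) (m≤0 (m i) (i , refl))) } ) , μ⋃≡v
      where
      small : ∀ {B} v → μ-Graph B v → v ≤ 0ₜ → Small B
      small 0ₜ μB≡0 _ = μB≡0

    restrict : X → Λ ^< κ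
    restrict x = α , λ i → x (proj₁ i)

    small-singleton : ∀ x → Small ｛ x ｝
    small-singleton x = small-⊆ (λ { refl _ → refl }) (small-cone (proj₂ (restrict x)))

    cone-open : ∀ s → IsUnionOfCones Λ κ (Cone Λ κ s)
    cone-open s x x∈s = s , x∈s , λ y∈s → y∈s

  smallnessMeasure : ¬ ((K.Seg α → ∣ Λ ∣) ≤ᶜ ∣ Λ ∣) →
                     Σ[ M ∈ WeakMeasureSpace Λ (boundedTopology Λ κ) (two ℓ) (supremum em) ]
                     WeakMeasureSpace.IsContinuous M
  smallnessMeasure Λ^α≰Λ = record
    { 𝔐 = λ _ → ⊤ₚ
    -- Since `𝔐` contains every set, all the closure conditions end in the unit type.
    ; isWeaklyMeasurable = _
    ; μ = record { Graph = μ-Graph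
                 ; respects = λ {_} {_} {v} → μ-respects {v = v}
                 ; functional = λ {_} {v} {w} → μ-functional {v = v} {w} }
    ; isMeasure = record
      { 𝔐⊆dom       = λ {A} _ → μ-total A
      ; empty       = (λ _ _ → origin) , λ ()
      ; positive    = 1ₜ , space-not-small Λ^α≰Λ , _ , λ ()
      ; monotone    = λ A B _ _ A⊆B → μ-monotone A⊆B
      ; additive    = λ γ γ<Λ⁺ A _ _ m μA≡m → μ-additive γ<Λ⁺ A m μA≡m
      ; point-value = λ x _ γ _ A local-basis v μx≡v →
          (λ { p (i , μAᵢ≡p) → μ-monotone (λ { refl → contains local-basis i }) v p μx≡v μAᵢ≡p }) ,
          -- Some member of the local basis lies in the cone of length `α` around `x`, so it is
          -- small: 0 is among the values, and every lower bound `u` is at most 0.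
          λ u u≤μA →
            let i , Aᵢ⊆cone = basis local-basis (Cone Λ κ (restrict x)) (cone-open _) (λ _ → refl)
                Aᵢ-small = small-⊆ Aᵢ⊆cone (small-cone _)
            in ≤-trans u 0ₜ v (u≤μA 0ₜ (i , Aᵢ-small)) _
      }
    } , λ x → _ , small-singleton x
    where open IsOpenLocalBasis

corollary8p5 : (ℓ : Level) → ExcludedMiddle (lsuc ℓ) → Extensionality ℓ ℓ →
    (κ Λ : InfiniteCardinal ℓ) → ∣ κ ∣ ≤ᶜ ∣ Λ ∣ → Regular κ →
    ∣ Λ ∣ <ᶜ (Λ ^< κ) →
    Σ[ 𝕊 ∈ PositivelyTotallyOrderedMonoid ℓ ]
    Σ[ σ ∈ InfinitarySum 𝕊 ]
    Σ[ M ∈ WeakMeasureSpace Λ (boundedTopology Λ κ) 𝕊 σ ]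
    WeakMeasureSpace.IsContinuous M
corollary8p5 ℓ em⁺ ext κ Λ κ≤Λ _ (_ , Λ^<κ≰Λ) =
  let em = lower-excludedMiddle em⁺
      α , Λ^α≰Λ = ∃-large-exponent em ext κ Λ κ≤Λ Λ^<κ≰Λ
  in two ℓ , supremum em , smallnessMeasure em ext κ Λ α Λ^α≰Λ
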